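{- Let $G$ be a connected planar graph (loops and multiple edges allowed) associated to a link shadow $D$, and let $v$ and $e$ denote the number of vertices and edges of $G$, respectively. If $e$ is even and $2(v-1)\neq e$, then $D$ is an $L$-position diagram for the Link Smoothing Game; that is, player $L$ can guarantee a win regardless of whether $L$ moves first or second.
   Context: A link shadow $D$ is a connected link diagram in which under/over information is unspecified at the crossings (called precrossings). Link Smoothing Game on $D$: two players, $K$ (Knot) and $L$ (Link), alternately select a remaining precrossing and replace it by either of its two smoothings (horizontal or vertical), until no precrossings remain. $K$ wins if the final diagram is connected; $L$ wins if it is disconnected (once disconnected, the diagram stays disconnected). Graph of a shadow: checkerboard color the regions of $D$; the (black) graph $G$ has one vertex per black region and one edge per precrossing, joining the black regions meeting there (loops and multi-edges allowed). $G$ is a connected plane graph; the white graph is its planar dual $G^*$. Every connected plane graph arises in this way. Smoothing a precrossing amounts to either deleting the corresponding edge of $G$ (and contracting the dual edge in $G^*$) or contracting it in $G$ (and deleting the dual edge in $G^*$). The shadow is connected if and only if both graphs are connected. Thus, on $G$, players alternately choose a remaining edge and delete or contract it; $L$ wins as soon as a cut edge is deleted or a loop is contracted (the latter deletes a cut edge of the dual), and $K$ wins if all edges are used up without this ever happening. $L$-position means that $L$ has a winning strategy both when moving first and when moving second. -}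

module Defs where

open import Data.Bool using (Bool; true; not)
open import Data.Fin using (Fin)
open import Data.Fin.Patterns using (0F; 1F; 2F; 3F)
open import Data.Maybe using (Maybe; just; nothing)
open import Data.Nat using (ℕ; _+_; _*_)
open import Data.Product using (_×_; _,_; ∃; proj₁; proj₂)
open import Data.Unit using (⊤)
open import Data.Vec using (Vec; lookup; replicate; _[_]≔_)
open import Function.Bundles using (_↔_; _⇔_; Inverse)
open import Function.Definitions using (StrictlySurjective)
open import Relation.Binary.Construct.Closure.Equivalence using (EqClosure)
open import Relation.Binary.PropositionalEquality using (_≡_; _≢_)
open import Relation.Nullary using (¬_)

-- A plane diagram is described as a 4-valent combinatorial map.  The four
-- arc ends at each crossing are numbered 0, 1, 2, 3 counterclockwise.

End : ℕ → Set
End n = Fin n × Fin 4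

ccw cw : Fin 4 → Fin 4
ccw 0F = 1F
ccw 1F = 2F
ccw 2F = 3F
ccw 3F = 0F
cw 0F = 3F
cw 1F = 0F
cw 2F = 1F
cw 3F = 2F

next prev : ∀ {n} → End n → End n
next (c , i) = c , ccw i
prev (c , i) = c , cw i

-- Which smoothing is called horizontal depends on the numbering of the ends
-- at the crossing; only the pair of them matters.

data Smoothing : Set where
  horizontal vertical : Smoothing

-- The end to which a smoothing joins a given end of the crossing.

partner : Smoothing → Fin 4 → Fin 4
partner horizontal 0F = 1F
partner horizontal 1F = 0F
partner horizontal 2F = 3F
partner horizontal 3F = 2F
partner vertical   0F = 3F
partner vertical   1F = 2F
partner vertical   2F = 1F
partner vertical   3F = 0F

-- A position records the smoothing made at each crossing; `nothing` marks
-- a precrossing.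

Position : ℕ → Set
Position n = Vec (Maybe Smoothing) n

initial : ∀ n → Position n
initial n = replicate n nothing

-- `opposite x` is the other end of the arc that has x as one of its ends.

data Joined {n : ℕ} (opposite : End n → End n) (p : Position n) : End n → End n → Set where
  arc         : ∀ x → Joined opposite p x (opposite x)
  smoothed    : ∀ c i s → lookup p c ≡ just s →
                Joined opposite p (c , i) (c , partner s i)
  precrossing : ∀ c i j → lookup p c ≡ nothing →
                Joined opposite p (c , i) (c , j)

AllConnected : ∀ {n} → (End n → End n) → Position n → Set
AllConnected opposite p = ∀ x y → EqClosure (Joined opposite p) x y

-- The corner of crossing c between ends i and i + 1 is also denoted (c , i).
-- It lies to the left when leaving c along end i; keeping its region on the
-- left, one arrives at the other end of that arc, and the corner met there
-- is the one clockwise from that end.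

data BoundaryStep {n : ℕ} (opposite : End n → End n) : End n → End n → Set where
  along : ∀ x → BoundaryStep opposite x (prev (opposite x))

-- A connected diagram with at least one precrossing.  As it is connected, each
-- region is a disc with a single boundary walk, and planarity is Euler's
-- formula V + F = E + 2 for n crossings and 2n arcs.  The formula excludes n = 0.

record CrossingShadow : Set where
  field
    n               : ℕ
    opposite        : End n → End n
    involutive      : ∀ x → opposite (opposite x) ≡ x
    no-fixed-end    : ∀ x → opposite x ≢ x
    connected       : AllConnected opposite (initial n)
    regions         : ℕ
    region          : End n → Fin regions
    region-onto     : StrictlySurjective _≡_ region
    region-boundary : ∀ x y → region x ≡ region y ⇔ EqClosure (BoundaryStep opposite) x y
    planar          : n + regions ≡ 2 * n + 2

-- The circle without crossings is the one connected diagram that has no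
-- arc ends, and so it is listed separately.

data Shadow : Set where
  circle  : Shadow
  diagram : CrossingShadow → Shadow

open CrossingShadow

crossings : Shadow → ℕ
crossings circle      = 0
crossings (diagram D) = n D

Region : Shadow → Set
Region circle      = Fin 2
Region (diagram D) = Fin (regions D)

corner : (D : Shadow) → End (crossings D) → Region D
corner circle      (() , _)
corner (diagram D) x = region D x

-- The regions on the two sides of an arc.

data Adjacent : (D : Shadow) → Region D → Region D → Set where
  across-circle : Adjacent circle 0F 1F
  across-arc    : ∀ {D} x → Adjacent (diagram D) (region D x) (region D (prev x))

Connected : (D : Shadow) → Position (crossings D) → Set
Connected circle      p = ⊤
Connected (diagram D) p = AllConnected (opposite D) p

-- The pair of end vertices of an edge carries an order without significance.

record Multigraph : Set where
  field
    v    : ℕ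
    e    : ℕ
    ends : Fin e → Fin v × Fin v

-- The two black corners at a crossing are opposite, so they are i and i + 2
-- for some i; either of the two may be given as i.

record _IsGraphOf_ (G : Multigraph) (D : Shadow) : Set where
  open Multigraph G
  field
    black        : Region D → Bool
    checkerboard : ∀ {r r′} → Adjacent D r r′ → black r′ ≡ not (black r)
    vertices     : Fin v ↔ ∃ λ r → black r ≡ true
    edges        : Fin e ↔ Fin (crossings D)

  vertexRegion : Fin v → Region D
  vertexRegion a = proj₁ (Inverse.to vertices a)

  field
    incidence : ∀ k → ∃ λ i → let x = (Inverse.to edges k , i) in
                vertexRegion (proj₁ (ends k)) ≡ corner D x ×
                vertexRegion (proj₂ (ends k)) ≡ corner D (next (next x))

data Player : Set where
  K L : Player

-- `LWins D m p`: L has a winning strategy from position p with m to move.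

data LWins (D : Shadow) : Player → Position (crossings D) → Set where
  game-over : ∀ {m p} → (∀ c → lookup p c ≢ nothing) → ¬ Connected D p → LWins D m p
  L-moves   : ∀ {p} c s → lookup p c ≡ nothing →
              LWins D K (p [ c ]≔ just s) → LWins D L p
  K-moves   : ∀ {p} → (∃ λ c → lookup p c ≡ nothing) →
              (∀ c s → lookup p c ≡ nothing → LWins D L (p [ c ]≔ just s)) →
              LWins D K p

LPosition : Shadow → Set
LPosition D = ∀ m → LWins D m (initial (crossings D))

{-# OPTIONS --safe #-}

-- If the final diagram is one curve, then walking along it with the black
-- regions on one side shows that the contracted edges connect the v black
-- regions, so at least v - 1 edges are contracted; likewise at least w - 1 edges
-- are deleted, where w = e + 2 - v counts the white regions.  As there are e
-- edges, exactly v - 1 are contracted.  With e even, L makes e / 2 of the moves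
-- whoever begins, so L always contracts if v - 1 < e / 2 and always deletes if
-- v - 1 > e / 2.

module Submission where

open import Defs
open import Data.Bool using (Bool; true; false; not; if_then_else_)
open import Data.Bool.Properties using (¬-not; not-¬; not-involutive) renaming (_≟_ to _≟ᵇ_)
open import Data.Fin using (Fin; zero; suc; punchIn; punchOut)
open import Data.Fin.Patterns using (0F; 1F; 2F; 3F)
open import Data.Fin.Permutation using (↔⇒≡)
open import Data.Fin.Properties using (_≟_; injective⇒≤; punchInᵢ≢i; punchOut-cong;
  punchOut-punchIn)
open import Data.Fin.Subset using (Subset; inside; outside; _∈_; ∣_∣; ⊤; ∁)
open import Data.Fin.Subset.Properties using (∣⊤∣≡n; ∣⊥∣≡0; ∣p∣≤n; ∣∁p∣≡n∸∣p∣; ∈⊤;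
  Empty-unique; nonempty?)
open import Data.Maybe using (Maybe; just; nothing; is-nothing)
open import Data.Nat using (ℕ; zero; suc; _+_; _*_; _∸_; _≤_; _<_; z≤n; s≤s⁻¹; ⌊_/2⌋; ⌈_/2⌉)
open import Data.Nat.Divisibility using (_∣_; divides)
open import Data.Nat.Properties hiding (_≟_)
open import Data.Product using (_×_; _,_; ∃; proj₁; proj₂)
open import Data.Sum using (_⊎_; inj₁; inj₂)
open import Data.Vec using (lookup; tabulate; []; _∷_; here; there; _[_]≔_)
open import Data.Vec.Properties using (tabulate-cong; tabulate-∘; lookup∘tabulate;
  lookup∘update; lookup∘update′; []=⇒lookup; lookup⇒[]=)
open import Function using (_∘_; id)
open import Function.Bundles using (_↔_; Inverse; Equivalence)
open import Function.Definitions using (StrictlySurjective)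
open import Relation.Binary.Construct.Closure.Equivalence using (gfold)
import Relation.Binary.Construct.Closure.ReflexiveTransitive as Star
import Relation.Binary.Construct.Closure.Symmetric as Sym
open import Relation.Binary.PropositionalEquality using (_≡_; _≢_; refl; sym; trans;
  cong; subst; isEquivalence)
open import Relation.Binary.Definitions using (tri<; tri≈; tri>)
open import Relation.Nullary using (yes; no; does; contradiction)

-- Cardinalities of finite subsets and quotients of finite sets.

fibre-≡ : ∀ {A : Set} {f : A → Bool} {b} {x y : ∃ λ a → f a ≡ b} → proj₁ x ≡ proj₁ y → x ≡ y
fibre-≡ {x = _ , refl} {_ , refl} refl = refl

-- A move alters a single entry, so this one statement serves two counts: the hits, which grow, and
-- the precrossings, which shrink.
∣tabulate∣-insert : ∀ {n} {f g : Fin n → Bool} c → f c ≡ false → g c ≡ true →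
                    (∀ d → d ≢ c → g d ≡ f d) →
                    ∣ tabulate g ∣ ≡ suc ∣ tabulate f ∣
∣tabulate∣-insert {f = f} {g} zero f0 g0 same rewrite f0 | g0 =
  cong (suc ∘ ∣_∣) (tabulate-cong λ d → same (suc d) λ ())
∣tabulate∣-insert {f = f} {g} (suc c) fc gc same rewrite same zero (λ ()) with f zero
... | true  = cong suc (∣tabulate∣-insert c fc gc λ d d≢c → same (suc d) λ { refl → d≢c refl })
... | false = ∣tabulate∣-insert c fc gc λ d d≢c → same (suc d) λ { refl → d≢c refl }

∈-tabulate⁺ : ∀ {n} {f : Fin n → Bool} {c} → f c ≡ true → c ∈ tabulate f
∈-tabulate⁺ {f = f} {c} fc = lookup⇒[]= c _ (trans (lookup∘tabulate f c) fc)

∈-tabulate⁻ : ∀ {n} {f : Fin n → Bool} {c} → c ∈ tabulate f → f c ≡ true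
∈-tabulate⁻ {f = f} {c} c∈ = trans (sym (lookup∘tabulate f c)) ([]=⇒lookup c∈)

constant-onto⇒≤1 : ∀ {A : Set} {j} {f : A → Fin j} → StrictlySurjective _≡_ f →
                   (∀ x y → f x ≡ f y) → j ≤ 1
constant-onto⇒≤1 {j = zero}        _    _        = z≤n
constant-onto⇒≤1 {j = suc zero}    _    _        = ≤-refl
constant-onto⇒≤1 {j = suc (suc _)} onto constant with onto 0F | onto 1F
... | x , x↦0 | y , y↦1 with () ← trans (sym x↦0) (trans (constant x y) y↦1)

-- The bound `k ≤ suc j` instead of an equality admits `x ≡ y`, where nothing is glued and `f` is
-- the identity.
identify-pair : ∀ {k} (x y : Fin k) → ∃ λ j → ∃ λ (f : Fin k → Fin j) →
                StrictlySurjective _≡_ f × f x ≡ f y × k ≤ suc j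
identify-pair {k} x y with x ≟ y
... | yes refl = k , id , (λ z → z , refl) , refl , n≤1+n k
identify-pair {suc j} x y | no x≢y = j , f , onto , fx≡fy , ≤-refl
  where
  f : Fin (suc j) → Fin j
  f z with x ≟ z
  -- `x` takes the place that `y` has among the elements other than `x`.
  ... | yes _   = punchOut x≢y
  ... | no  x≢z = punchOut x≢z
  onto : StrictlySurjective _≡_ f
  onto w = punchIn x w , eq
    where
    eq : f (punchIn x w) ≡ w
    eq with x ≟ punchIn x w
    ... | yes x≡ = contradiction (sym x≡) (punchInᵢ≢i x w)
    ... | no  _  = trans (punchOut-cong x refl) (punchOut-punchIn x)
  fx≡fy : f x ≡ f y
  fx≡fy with x ≟ x | x ≟ y
  ... | yes _  | yes _ = refl
  ... | yes _  | no _  = punchOut-cong x refl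
  ... | no x≢x | _     = contradiction refl x≢x

-- Adding the edges of `S` one at a time, each merges at most two classes. This is the bound that a
-- graph with `k` vertices and edge set `S` has at least `k - ∣ S ∣` components; `f` is a quotient
-- that is constant on them.
components : ∀ {n k} (ends : Fin n → Fin k × Fin k) (S : Subset n) →
             ∃ λ j → ∃ λ (f : Fin k → Fin j) →
             StrictlySurjective _≡_ f ×
             (∀ {i} → i ∈ S → f (proj₁ (ends i)) ≡ f (proj₂ (ends i))) ×
             k ≤ ∣ S ∣ + j
components {k = k} ends [] = k , id , (λ z → z , refl) , (λ ()) , ≤-refl
components ends (outside ∷ S) with components (ends ∘ suc) S
... | j , f , onto , glue , k≤ = j , f , onto , (λ { (there i∈S) → glue i∈S }) , k≤
components ends (inside ∷ S) with components (ends ∘ suc) S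
... | j , f , onto , glue , k≤
  with identify-pair (f (proj₁ (ends zero))) (f (proj₂ (ends zero)))
... | j′ , g , g-onto , g≡ , j≤ =
  j′ , g ∘ f , onto′ , (λ { here → g≡ ; (there i∈S) → cong g (glue i∈S) }) ,
  ≤-trans k≤ (≤-trans (+-monoʳ-≤ ∣ S ∣ j≤) (≤-reflexive (+-suc ∣ S ∣ j′)))
  where
  onto′ : StrictlySurjective _≡_ (g ∘ f)
  onto′ w with g-onto w
  ... | y , refl with onto y
  ... | x , refl = x , refl

-- Smoothings, and how a move changes the counts.

other : Smoothing → Smoothing
other horizontal = vertical
other vertical   = horizontal

matches : Smoothing → Maybe Smoothing → Bool
matches _          nothing           = false
matches horizontal (just horizontal) = true
matches horizontal (just vertical)   = false
matches vertical   (just horizontal) = false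
matches vertical   (just vertical)   = true

matches-refl : ∀ s → matches s (just s) ≡ true
matches-refl horizontal = refl
matches-refl vertical   = refl

matches-other : ∀ s {x} → x ≢ nothing → matches (other s) x ≡ not (matches s x)
matches-other s          {nothing}         x≢ = contradiction refl x≢
matches-other horizontal {just horizontal} _  = refl
matches-other horizontal {just vertical}   _  = refl
matches-other vertical   {just horizontal} _  = refl
matches-other vertical   {just vertical}   _  = refl

same-or-other : ∀ s t → s ≡ t ⊎ s ≡ other t
same-or-other horizontal horizontal = inj₁ refl
same-or-other horizontal vertical   = inj₂ refl
same-or-other vertical   horizontal = inj₂ refl
same-or-other vertical   vertical   = inj₁ refl

Full : ∀ {n} → Position n → Set
Full p = ∀ c → lookup p c ≢ nothing

-- `aim` is the smoothing that L wants at each crossing. It counts whichever player made it.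
hits : ∀ {n} → (Fin n → Smoothing) → Position n → Subset n
hits aim p = tabulate λ c → matches (aim c) (lookup p c)

precrossings : ∀ {n} → Position n → Subset n
precrossings p = tabulate (is-nothing ∘ lookup p)

is-nothing⇒≡ : ∀ {x : Maybe Smoothing} → is-nothing x ≡ true → x ≡ nothing
is-nothing⇒≡ {nothing} _ = refl

module _ {n} (p : Position n) {c} (free : lookup p c ≡ nothing) where

  precrossings-move : ∀ s → ∣ precrossings p ∣ ≡ suc ∣ precrossings (p [ c ]≔ just s) ∣
  precrossings-move s = ∣tabulate∣-insert c
    (cong is-nothing (lookup∘update c p (just s))) (cong is-nothing free)
    (λ d d≢c → cong is-nothing (sym (lookup∘update′ d≢c p (just s))))

  hits-aim : ∀ aim → ∣ hits aim (p [ c ]≔ just (aim c)) ∣ ≡ suc ∣ hits aim p ∣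
  hits-aim aim = ∣tabulate∣-insert c (cong (matches (aim c)) free)
    (trans (cong (matches (aim c)) (lookup∘update c p _)) (matches-refl (aim c)))
    (λ d d≢c → cong (matches (aim d)) (lookup∘update′ d≢c p _))

  -- A move fills a precrossing, which was not a hit, so no hit is ever lost.
  hits-move : ∀ aim s → ∣ hits aim p ∣ ≤ ∣ hits aim (p [ c ]≔ just s) ∣
  hits-move aim s with same-or-other s (aim c)
  ... | inj₁ refl = ≤-trans (n≤1+n _) (≤-reflexive (sym (hits-aim aim)))
  ... | inj₂ refl = ≤-reflexive (cong ∣_∣ (tabulate-cong unchanged))
    where
    miss : ∀ t → matches t (just (other t)) ≡ false
    miss horizontal = refl
    miss vertical   = refl
    unchanged : ∀ d → matches (aim d) (lookup p d) ≡
                      matches (aim d) (lookup (p [ c ]≔ just (other (aim c))) d)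
    unchanged d with d ≟ c
    ... | yes refl = trans (cong (matches (aim c)) free)
                       (sym (trans (cong (matches (aim c)) (lookup∘update c p _)) (miss (aim c))))
    ... | no d≢c   = cong (matches (aim d)) (sym (lookup∘update′ d≢c p _))

no-precrossing : ∀ {n} (p : Position n) → ∣ precrossings p ∣ ≡ 0 → Full p
no-precrossing p none c free with () ← trans (sym none) (precrossings-move p free horizontal)

some-precrossing : ∀ {n m} (p : Position n) → ∣ precrossings p ∣ ≡ suc m →
                   ∃ λ c → lookup p c ≡ nothing
some-precrossing {n} p some with nonempty? (precrossings p)
... | yes (c , c∈) = c , is-nothing⇒≡ (∈-tabulate⁻ c∈)
... | no  empty
  with () ← trans (sym some) (trans (cong ∣_∣ (Empty-unique empty)) (∣⊥∣≡0 n))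

-- The strategy of always making the wanted smoothing.

module Game (D : Shadow) (aim : Fin (crossings D) → Smoothing) (h : ℕ)
            (few-hits : ∀ p → Full p → Connected D p → ∣ hits aim p ∣ < h) where

  -- By `few-hits`, a full position with `h` hits cannot be connected. The summand 0 is both halves
  -- of 0, so both recursions below end here.
  over : ∀ {m} p → ∣ precrossings p ∣ ≡ 0 → h ≤ ∣ hits aim p ∣ + 0 → LWins D m p
  over p none enough = game-over full λ conn →
    <⇒≱ (few-hits p full conn) (≤-trans enough (≤-reflexive (+-identityʳ _)))
    where full = no-precrossing p none

  -- With m precrossings left, L still has ⌈ m /2⌉ moves if L moves next, and
  -- ⌊ m /2⌋ otherwise.
  L-first : ∀ m p → ∣ precrossings p ∣ ≡ m → h ≤ ∣ hits aim p ∣ + ⌈ m /2⌉ → LWins D L p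
  K-first : ∀ m p → ∣ precrossings p ∣ ≡ m → h ≤ ∣ hits aim p ∣ + ⌊ m /2⌋ → LWins D K p

  L-first zero    p left enough = over p left enough
  L-first (suc m) p left enough with some-precrossing p left
  ... | c , free = L-moves c (aim c) free
    (K-first m _ (suc-injective (trans (sym (precrossings-move p free (aim c))) left))
      -- `⌈ suc m /2⌉` reduces to `suc ⌊ m /2⌋`: the move that L has used up reappears as a hit.
      (≤-trans enough (≤-reflexive
        (trans (+-suc _ _) (cong (_+ ⌊ m /2⌋) (sym (hits-aim p free aim)))))))

  K-first zero    p left enough = over p left enough
  K-first (suc m) p left enough = K-moves (some-precrossing p left) λ c s free →
    L-first m _ (suc-injective (trans (sym (precrossings-move p free s)) left))
      (≤-trans enough (+-monoˡ-≤ ⌈ m /2⌉ (hits-move p free aim s)))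

  ∣precrossings-initial∣ : ∣ precrossings (initial (crossings D)) ∣ ≡ crossings D
  ∣precrossings-initial∣ = go (crossings D)
    where
    go : ∀ n → ∣ precrossings (initial n) ∣ ≡ n
    go zero    = refl
    go (suc n) = cong suc (go n)

  lposition : crossings D ≡ h + h → LPosition D
  lposition n≡ m = go m
    where
    half : h ≤ ⌊ crossings D /2⌋
    half = ≤-reflexive (trans (n≡⌊n+n/2⌋ h) (cong ⌊_/2⌋ (sym n≡)))
    go : ∀ m → LWins D m (initial (crossings D))
    go K = K-first _ _ ∣precrossings-initial∣ (≤-trans half (m≤n+m _ _))
    go L = L-first _ _ ∣precrossings-initial∣
             (≤-trans half (≤-trans (⌊n/2⌋≤⌈n/2⌉ _) (m≤n+m _ _)))

-- Checkerboard colourings and the regions beside an arc.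

module Coloured (D : CrossingShadow)
  (colour : Fin (CrossingShadow.regions D) → Bool)
  (checkerboard : ∀ x → colour (CrossingShadow.region D (prev x)) ≡
                        not (colour (CrossingShadow.region D x))) where

  open CrossingShadow D

  Coloured : Bool → Set
  Coloured b = ∃ λ r → colour r ≡ b

  prev-colour : ∀ {b} x → colour (region x) ≢ b → colour (region (prev x)) ≡ b
  prev-colour {b} x ≢b = trans (checkerboard x) (trans (cong not (¬-not ≢b)) (not-involutive b))

  -- Exactly one of the two regions beside an end has colour `b`. A walk along the final curves
  -- keeps this region on arcs and at separating smoothings, and can change it only at merging ones.
  side : ∀ b → End n → Coloured b
  side b x with colour (region x) ≟ᵇ b
  ... | yes ≡b = region x , ≡b
  ... | no  ≢b = region (prev x) , prev-colour x ≢b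

  Borders : Fin regions → End n → Set
  Borders r x = r ≡ region x ⊎ r ≡ region (prev x)

  side-unique : ∀ {b} x (r : Coloured b) → Borders (proj₁ r) x → side b x ≡ r
  side-unique {b} x (r , r≡b) borders with colour (region x) ≟ᵇ b
  side-unique x (r , r≡b) (inj₁ refl) | yes _  = fibre-≡ refl
  side-unique x (r , r≡b) (inj₁ refl) | no ≢b  = contradiction r≡b ≢b
  side-unique x (r , r≡b) (inj₂ refl) | yes ≡b =
    contradiction (trans (sym r≡b) (checkerboard x)) (not-¬ (sym ≡b))
  side-unique x (r , r≡b) (inj₂ refl) | no _   = fibre-≡ refl

  side-borders : ∀ b x → Borders (proj₁ (side b x)) x
  side-borders b x with colour (region x) ≟ᵇ b
  ... | yes _ = inj₁ refl
  ... | no  _ = inj₂ refl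

  side-shared : ∀ {b} x y (r : Coloured b) → Borders (proj₁ r) x → Borders (proj₁ r) y →
                side b x ≡ side b y
  side-shared x y r rx ry = trans (side-unique x r rx) (sym (side-unique y r ry))

  region-opposite : ∀ x → region x ≡ region (prev (opposite x))
  region-opposite x = Equivalence.from (region-boundary x _) (Sym.fwd (along x) Star.◅ Star.ε)

  -- The two ends of an arc lie beside the same two regions, in exchanged order.
  side-opposite : ∀ b x → side b (opposite x) ≡ side b x
  side-opposite b x = side-unique (opposite x) (side b x) (swap (side-borders b x))
    where
    swap : ∀ {r} → Borders r x → Borders r (opposite x)
    swap (inj₁ r≡) = inj₂ (trans r≡ (region-opposite x))
    swap (inj₂ r≡) = inj₁ (trans r≡ (sym (trans (region-opposite (opposite x))
                                                (cong (region ∘ prev) (involutive x)))))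

  -- The smoothing that merges the two corners of colour b.
  merging : Bool → Fin n → Smoothing
  merging b c = if does (colour (region (c , 0F)) ≟ᵇ b) then vertical else horizontal

  merging-not : ∀ b c → merging (not b) c ≡ other (merging b c)
  merging-not b c with colour (region (c , 0F))
  merging-not true  c | true  = refl
  merging-not true  c | false = refl
  merging-not false c | true  = refl
  merging-not false c | false = refl

  -- The ends that a separating smoothing joins bound a common corner of colour `b`: corner 0 or 2
  -- if corner 0 has this colour, corner 1 or 3 if not.
  separating-side : ∀ b c i → side b (c , i) ≡ side b (c , partner (other (merging b c)) i)
  separating-side b c with colour (region (c , 0F)) ≟ᵇ b
  ... | yes 0≡b = λ
    { 0F → share₀
    ; 1F → sym share₀
    ; 2F → share₂
    ; 3F → sym share₂ }
    where
    2≡b : colour (region (c , 2F)) ≡ b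
    2≡b = prev-colour (c , 3F) λ 3≡b → not-¬ (sym 0≡b) (trans (sym 3≡b) (checkerboard (c , 0F)))
    share₀ = side-shared (c , 0F) (c , 1F) (region (c , 0F) , 0≡b) (inj₁ refl) (inj₂ refl)
    share₂ = side-shared (c , 2F) (c , 3F) (region (c , 2F) , 2≡b) (inj₁ refl) (inj₂ refl)
  ... | no 0≢b = λ
    { 0F → share₃
    ; 1F → share₁
    ; 2F → sym share₁
    ; 3F → sym share₃ }
    where
    3≡b : colour (region (c , 3F)) ≡ b
    3≡b = prev-colour (c , 0F) 0≢b
    1≡b : colour (region (c , 1F)) ≡ b
    1≡b = prev-colour (c , 2F) λ 2≡b → not-¬ (sym 3≡b) (trans (sym 2≡b) (checkerboard (c , 3F)))
    share₃ = side-shared (c , 0F) (c , 3F) (region (c , 3F) , 3≡b) (inj₂ refl) (inj₁ refl)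
    share₁ = side-shared (c , 1F) (c , 2F) (region (c , 1F) , 1≡b) (inj₁ refl) (inj₂ refl)

  -- A separating smoothing joins ends 1 and 3 to ends 0 and 2 in some order, so the latter two
  -- represent both corners of colour `b`, that is, both end vertices of the edge.
  side-0-or-2 : ∀ b c i → side b (c , i) ≡ side b (c , 0F) ⊎ side b (c , i) ≡ side b (c , 2F)
  side-0-or-2 b c i with merging b c | separating-side b c
  side-0-or-2 b c 0F | _          | _    = inj₁ refl
  side-0-or-2 b c 1F | horizontal | same = inj₂ (same 1F)
  side-0-or-2 b c 1F | vertical   | same = inj₁ (same 1F)
  side-0-or-2 b c 2F | _          | _    = inj₂ refl
  side-0-or-2 b c 3F | horizontal | same = inj₁ (same 3F)
  side-0-or-2 b c 3F | vertical   | same = inj₂ (same 3F)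

  -- Merging the corners of one colour separates those of the other, so each smoothed crossing is a
  -- hit for exactly one colour.
  hits-not : ∀ b {p} → Full p → ∣ hits (merging (not b)) p ∣ + ∣ hits (merging b) p ∣ ≡ n
  hits-not b {p} full = trans (cong (_+ ∣ S ∣) (trans (cong ∣_∣ complement) (∣∁p∣≡n∸∣p∣ S)))
                              (m∸n+n≡m (∣p∣≤n S))
    where
    S = hits (merging b) p
    complement : hits (merging (not b)) p ≡ ∁ S
    complement = trans
      (tabulate-cong λ c → trans (cong (λ s → matches s (lookup p c)) (merging-not b c))
                                 (matches-other (merging b c) (full c)))
      (tabulate-∘ not _)

  -- Connected final diagrams and the number of merges.

  module _ {b k j} (class : Coloured b → Fin k) {p : Position n} (full : Full p)
           (conn : AllConnected opposite p) (f : Fin k → Fin j)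
           (glue : ∀ {c} → c ∈ hits (merging b) p →
                   f (class (side b (c , 0F))) ≡ f (class (side b (c , 2F)))) where

    -- The class of the region of colour `b` at the side is invariant along the final curves, and
    -- each region lies beside some end.
    connected⇒constant : ∀ r r′ → f (class r) ≡ f (class r′)
    connected⇒constant r r′ with region-onto (proj₁ r) | region-onto (proj₁ r′)
    ... | x , x≡r | y , y≡r′ = trans (sym (at r x≡r))
        (trans (gfold isEquivalence value respects (conn x y)) (at r′ y≡r′))
      where
      value : End n → Fin j
      value = f ∘ class ∘ side b
      at : ∀ r {x} → region x ≡ proj₁ r → value x ≡ f (class r)
      at r {x} x≡r = cong (f ∘ class) (side-unique x r (inj₁ (sym x≡r)))
      -- At a merging smoothing all four ends have one value, since `glue` identifies the two
      -- corners of colour `b`.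
      level : ∀ {c} → c ∈ hits (merging b) p → ∀ i → value (c , i) ≡ value (c , 0F)
      level {c} c∈ i with side-0-or-2 b c i
      ... | inj₁ eq = cong (f ∘ class) eq
      ... | inj₂ eq = trans (cong (f ∘ class) eq) (sym (glue c∈))
      respects : ∀ {x y} → Joined opposite p x y → value x ≡ value y
      respects (arc x) = cong (f ∘ class) (sym (side-opposite b x))
      respects (precrossing c i j free) = contradiction free (full c)
      respects (smoothed c i s p≡s) with same-or-other s (merging b c)
      ... | inj₂ refl = cong (f ∘ class) (separating-side b c i)
      ... | inj₁ refl = trans (level c∈ i) (sym (level c∈ _))
        where
        c∈ : c ∈ hits (merging b) p
        c∈ = ∈-tabulate⁺ (trans (cong (matches (merging b c)) p≡s) (matches-refl (merging b c)))

  -- Gluing along the merges leaves at most one class, while each merge removes at most one. A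
  -- general `class` is allowed because the white regions come without a numbering: black regions
  -- are classed by their vertex, white ones by a quotient of all regions.
  connected⇒merges : ∀ {b k} (class : Coloured b → Fin k) → StrictlySurjective _≡_ class →
                     ∀ {p} → Full p → AllConnected opposite p →
                     k ≤ suc ∣ hits (merging b) p ∣
  connected⇒merges {b} class class-onto {p} full conn
    with components (λ c → class (side b (c , 0F)) , class (side b (c , 2F)))
                    (hits (merging b) p)
  ... | j , f , f-onto , glue , k≤ =
    ≤-trans k≤ (≤-trans (+-monoʳ-≤ _ (constant-onto⇒≤1 f∘class-onto constant))
                        (≤-reflexive (+-comm _ 1)))
    where
    constant = connected⇒constant class full conn f glue
    f∘class-onto : StrictlySurjective _≡_ (f ∘ class)
    f∘class-onto w with f-onto w
    ... | y , refl with class-onto y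
    ... | r , refl = r , refl

  -- Euler's formula and the choice of the colour to merge.

  regions≡ : regions ≡ 2 + n
  regions≡ = +-cancelˡ-≡ n _ _
    (trans planar (trans (cong (_+ 2) (cong (n +_) (+-identityʳ n)))
      (trans (+-assoc n n 2) (cong (n +_) (+-comm n 2)))))

  -- Euler's formula supplies a region, hence an arc end, and each end has a white region beside it.
  white : Coloured false
  white = side false (proj₁ (region-onto (subst Fin (sym regions≡) 0F)))

  module _ {v} (vertices : Fin v ↔ Coloured true) where

    open Inverse vertices using (to; from; strictlyInverseˡ; strictlyInverseʳ)

    black-merges : ∀ {p} → Full p → AllConnected opposite p → v ≤ suc ∣ hits (merging true) p ∣
    black-merges = connected⇒merges from (λ a → to a , strictlyInverseʳ a)

    -- Identifying all black regions with one white region leaves at least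
    -- regions - v classes, and the white regions represent them all.
    white-merges : ∀ {p} → Full p → AllConnected opposite p → suc n ≤ v + ∣ hits (merging false) p ∣
    white-merges full conn with components (λ a → proj₁ (to a) , proj₁ white) ⊤
    ... | j , f , f-onto , glue , R≤ = s≤s⁻¹ (begin
        2 + n          ≡⟨ sym regions≡ ⟩
        regions        ≤⟨ R≤ ⟩
        ∣ ⊤ {v} ∣ + j  ≡⟨ cong (_+ j) (∣⊤∣≡n v) ⟩
        v + j          ≤⟨ +-monoʳ-≤ v (connected⇒merges (f ∘ proj₁) onto full conn) ⟩
        v + suc _      ≡⟨ +-suc v _ ⟩
        suc (v + _)    ∎)
      where
      open ≤-Reasoning
      onto : StrictlySurjective _≡_ (f ∘ proj₁)
      onto w with f-onto w
      ... | r , refl with colour r in r-colour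
      ... | false = (r , r-colour) , refl
      ... | true  = white , sym (trans (cong (f ∘ proj₁) (sym (strictlyInverseˡ (r , r-colour))))
                                       (glue {from (r , r-colour)} ∈⊤))

    lposition : ∀ h → n ≡ h + h → v ∸ 1 ≢ h → LPosition (diagram D)
    lposition h n≡h+h v-1≢h with <-cmp (v ∸ 1) h
    ... | tri≈ _ v-1≡h _ = contradiction v-1≡h v-1≢h
    ... | tri< v-1<h _ _ = Game.lposition (diagram D) (merging true) h few n≡h+h
      where
      open ≤-Reasoning
      few : ∀ p → Full p → AllConnected opposite p → ∣ hits (merging true) p ∣ < h
      few p full conn = begin-strict
        -- Since `w + b = n`, the white bound `n + 1 ≤ v + w` turns into `b < v`.
        b            <⟨ +-cancelˡ-≤ w (suc b) v (begin
                          w + suc b    ≡⟨ +-suc w b ⟩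
                          suc (w + b)  ≡⟨ cong suc (hits-not true {p} full) ⟩
                          suc n        ≤⟨ white-merges full conn ⟩
                          v + w        ≡⟨ +-comm v w ⟩
                          w + v        ∎) ⟩
        v            ≤⟨ m≤n+m∸n v 1 ⟩
        suc (v ∸ 1)  ≤⟨ v-1<h ⟩
        h            ∎
        where
        b = ∣ hits (merging true) p ∣
        w = ∣ hits (merging false) p ∣
    ... | tri> _ _ h<v-1 = Game.lposition (diagram D) (merging false) h few n≡h+h
      where
      open ≤-Reasoning
      few : ∀ p → Full p → AllConnected opposite p → ∣ hits (merging false) p ∣ < h
      -- The black bound gives `h < v ∸ 1 ≤ b`, so `w + b = h + h` leaves `w < h`.
      few p full conn = +-cancelʳ-≤ h (suc w) h (begin
        suc w + h    ≡⟨ +-suc w h ⟨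
        w + suc h    ≤⟨ +-monoʳ-≤ w h<v-1 ⟩
        w + (v ∸ 1)  ≤⟨ +-monoʳ-≤ w (∸-monoˡ-≤ 1 (black-merges full conn)) ⟩
        w + b        ≡⟨ hits-not true {p} full ⟩
        n            ≡⟨ n≡h+h ⟩
        h + h        ∎)
        where
        b = ∣ hits (merging true) p ∣
        w = ∣ hits (merging false) p ∣

-- The circle without crossings, and the result for all shadows.

-- The two regions have opposite colours. As `e` is 0 here, it follows that `2 * (v ∸ 1)` equals
-- `e`, so the hypothesis excludes the circle.
circle-one-vertex : ∀ {v} (black : Fin 2 → Bool) → black 1F ≡ not (black 0F) →
                    Fin v ↔ ∃ (λ r → black r ≡ true) → v ≤ 1
circle-one-vertex {v} black alternate vertices = injective⇒≤ {f = λ _ → 0F} λ {a} {b} _ →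
  trans (sym (strictlyInverseʳ a))
        (trans (cong from (unique (to a) (to b))) (strictlyInverseʳ b))
  where
  open Inverse vertices using (to; from; strictlyInverseʳ)
  unique : (r r′ : ∃ λ r → black r ≡ true) → r ≡ r′
  unique (0F , _) (0F , _) = fibre-≡ refl
  unique (1F , _) (1F , _) = fibre-≡ refl
  unique (0F , b₀) (1F , b₁) = contradiction alternate (not-¬ (trans b₁ (sym b₀)))
  unique (1F , b₁) (0F , b₀) = contradiction alternate (not-¬ (trans b₁ (sym b₀)))

theorem6 : (D : Shadow) (G : Multigraph) → G IsGraphOf D →
    2 ∣ Multigraph.e G → 2 * (Multigraph.v G ∸ 1) ≢ Multigraph.e G →
    LPosition D
theorem6 circle G isGraph _ e≢ =
  contradiction (trans (cong (2 *_) (m≤n⇒m∸n≡0 v≤1)) (sym (↔⇒≡ edges))) e≢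
  where
  open _IsGraphOf_ isGraph
  v≤1 = circle-one-vertex black (checkerboard across-circle) vertices
theorem6 (diagram D) G isGraph (divides h e≡h*2) e≢ =
  lposition vertices h n≡h+h λ v-1≡h →
    e≢ (trans (cong (2 *_) v-1≡h) (trans (*-comm 2 h) (sym e≡h*2)))
  where
  open _IsGraphOf_ isGraph
  open Coloured D black (λ x → checkerboard (across-arc x))
  n≡h+h : CrossingShadow.n D ≡ h + h
  n≡h+h = trans (sym (↔⇒≡ edges))
    (trans e≡h*2 (trans (*-comm h 2) (cong (h +_) (+-identityʳ h))))
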